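{- Let $k,t$ be positive integers with $t\le k-1$. Let $\mathcal{A}$ be a MIF$(k-t)$ and let $\mathcal{F}$ be a CIF$(k,t)$, where $\mathcal{A}$ and $\mathcal{F}$ have disjoint point sets. Then $\mathcal{F}\sqcup(\mathcal{A}\circledast\mathcal{F}^{\top})$ is a MIF$(k)$.
   Context: A family is a non-empty set of non-empty finite sets, called its blocks. The point set of a family $\mathcal{G}$ is $P_{\mathcal{G}}=\bigcup_{B\in\mathcal{G}}B$. A family is uniform if all its blocks have the same size, denoted $\mathrm{k}(\mathcal{G})$. A blocking set of $\mathcal{G}$ is a set meeting every block of $\mathcal{G}$. If $\mathcal{G}$ has a finite blocking set, $\mathrm{tr}(\mathcal{G})$ is the smallest size of a blocking set, a transversal is a blocking set of size $\mathrm{tr}(\mathcal{G})$, and $\mathcal{G}^{\top}$ is the family of all transversals of $\mathcal{G}$; otherwise $\mathrm{tr}(\mathcal{G})=\infty$. The symbol $\sqcup$ denotes disjoint union (of sets or of families). If $P_{\mathcal{G}}\cap P_{\mathcal{H}}=\emptyset$, then $\mathcal{G}\circledast\mathcal{H}=\{A\sqcup B: A\in\mathcal{G},B\in\mathcal{H}\}$. A MIF$(k)$ is a uniform family $\mathcal{F}$ with $\mathrm{k}(\mathcal{F})=k$, $\mathrm{tr}(\mathcal{F})<\infty$ and $\mathcal{F}=\mathcal{F}^{\top}$. A CIF$(k,t)$ is a uniform family $\mathcal{F}$ with $\mathrm{k}(\mathcal{F})=k$, $\mathrm{tr}(\mathcal{F})=t\le k-1$ and $\mathcal{F}=(\mathcal{F}\sqcup\mathcal{F}^{\top})^{\top}$.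 -}

module Defs where

open import Data.List.Base using (List; length)
open import Data.List.Membership.Propositional using () renaming (_∈_ to _∈ₗ_)
open import Data.List.Relation.Unary.Unique.Propositional using (Unique)
open import Data.Nat.Base using (ℕ; _≤_; _<_)
open import Data.Product.Base using (_×_; ∃; ∃₂)
open import Level using (Level; suc)
open import Relation.Binary.Core using (Rel)
open import Relation.Binary.Definitions using (_Respects_)
open import Relation.Binary.PropositionalEquality.Core using (_≡_)
open import Relation.Unary using (Pred; Satisfiable; _∪_; _⊥_; _≬_; _≐_)

private
  variable
    ℓ : Level
    X : Set ℓ

-- A finite set of points is given by a duplicate-free enumeration, so that the
-- length is its cardinality.  Enumerations that differ only in order are the
-- same set, hence the equality _≈_ (same members) instead of _≡_.
record FinSet (X : Set ℓ) : Set ℓ where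
  constructor finSet
  field
    elements : List X
    unique   : Unique elements

open FinSet public

⟦_⟧ : {X : Set ℓ} → FinSet X → Pred X ℓ
⟦ S ⟧ x = x ∈ₗ elements S

size : FinSet X → ℕ
size S = length (elements S)

infix 4 _≈_

_≈_ : {X : Set ℓ} → Rel (FinSet X) ℓ
S ≈ T = ⟦ S ⟧ ≐ ⟦ T ⟧

-- Not necessarily finite collections of finite sets.  Equality of collections
-- is _≐_.
Collection : Set ℓ → Set (suc ℓ)
Collection {ℓ} X = Pred (FinSet X) ℓ

record IsFamily {X : Set ℓ} (G : Collection X) : Set ℓ where
  field
    respects  : G Respects _≈_
    non-empty : Satisfiable G
    blocks    : ∀ {B} → G B → Satisfiable ⟦ B ⟧

Points : {X : Set ℓ} → Collection X → Pred X ℓ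
Points G x = ∃ λ B → G B × ⟦ B ⟧ x

Uniform : {X : Set ℓ} → Collection X → ℕ → Set ℓ
Uniform G k = ∀ {B} → G B → size B ≡ k

Blocking : {X : Set ℓ} → Collection X → Pred X ℓ → Set ℓ
Blocking G S = ∀ {B} → G B → S ≬ ⟦ B ⟧

FiniteTr : {X : Set ℓ} → Collection X → Set ℓ
FiniteTr G = ∃ λ S → Blocking G ⟦ S ⟧

-- "tr(G) = t".  It is a relation since the least size of a blocking set need
-- not exist (tr(G) = ∞) and is in general not computable.
record HasTr {X : Set ℓ} (G : Collection X) (t : ℕ) : Set ℓ where
  field
    attained : ∃ λ S → Blocking G ⟦ S ⟧ × size S ≡ t
    minimal  : ∀ S → Blocking G ⟦ S ⟧ → t ≤ size S

infix 9 _^⊤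

_^⊤ : {X : Set ℓ} → Collection X → Collection X
(G ^⊤) S = Blocking G ⟦ S ⟧ × HasTr G (size S)

-- "C = A ⊔ B", which includes that A and B are disjoint.
record _≈_⊔_ {X : Set ℓ} (C A B : FinSet X) : Set ℓ where
  field
    disjoint : ⟦ A ⟧ ⊥ ⟦ B ⟧
    union    : ⟦ C ⟧ ≐ (⟦ A ⟧ ∪ ⟦ B ⟧)

infixr 7 _⊛_

-- Only meaningful when Points G ⊥ Points H.
_⊛_ : {X : Set ℓ} → Collection X → Collection X → Collection X
(G ⊛ H) C = ∃₂ λ A B → G A × H B × C ≈ A ⊔ B

record MIF {X : Set ℓ} (k : ℕ) (F : Collection X) : Set ℓ where
  field
    isFamily : IsFamily F
    uniform  : Uniform F k
    finiteTr : FiniteTr F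
    maximal  : F ≐ F ^⊤

-- The union F ∪ F ^⊤ is automatically disjoint: the blocks of F have size k,
-- those of F ^⊤ have size t < k.
record CIF {X : Set ℓ} (k t : ℕ) (F : Collection X) : Set ℓ where
  field
    isFamily : IsFamily F
    uniform  : Uniform F k
    hasTr    : HasTr F t
    t<k      : t < k
    closed   : F ≐ (F ∪ F ^⊤) ^⊤

{-# OPTIONS --safe #-}
module Submission where

-- A block A ⊔ B of 𝒜 ⊛ ℱ^⊤ meets another such block inside 𝒜 and meets a block
-- of ℱ inside B.  Conversely let S block ℱ ⊔ (𝒜 ⊛ ℱ^⊤).  Either S also blocks
-- ℱ^⊤, so that |S| ≥ tr(ℱ ⊔ ℱ^⊤) = k, or S misses some B ∈ ℱ^⊤.  In the latter
-- case S meets every A ⊔ B inside A, hence S blocks 𝒜 as well as ℱ, and cutting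
-- S along the point set of 𝒜 gives |S| ≥ (k - t) + t.  In both cases equality
-- forces S to be a block.

open import Defs
open import Axiom.ExcludedMiddle using (ExcludedMiddle)
open import Data.List.Base using (filter; _++_)
open import Data.List.Membership.Propositional using (lose)
open import Data.List.Membership.Propositional.Properties
  using (∈-filter⁺; ∈-filter⁻; ∈-++⁺ˡ; ∈-++⁺ʳ; ∈-++⁻)
open import Data.List.Membership.Propositional.Properties.WithK using (unique∧set⇒bag)
open import Data.List.Properties using (length-++; filter-notAll)
open import Data.List.Relation.Binary.BagAndSetEquality using (∼bag⇒↭)
open import Data.List.Relation.Binary.Permutation.Propositional.Properties using (↭-length)
open import Data.List.Relation.Unary.Unique.Propositional.Properties using (++⁺; filter⁺)
open import Data.Nat.Base using (ℕ; _+_; _≤_; _<_; _∸_)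
open import Data.Nat.Properties
  using (≤-antisym; ≤-reflexive; ≤-trans; +-mono-≤; +-monoˡ-≤; +-monoʳ-≤;
         +-cancelˡ-≤; +-cancelʳ-≤; m∸n+n≡m; <⇒≤; <⇒≱)
open import Data.Product.Base using (_×_; _,_; ∃; proj₁; proj₂)
open import Data.Sum.Base using (inj₁; inj₂; [_,_]′)
open import Function.Base using (_∘_; id)
open import Function.Bundles using (mk⇔)
open import Level using (Level)
open import Relation.Binary.PropositionalEquality using (_≡_; refl; sym; trans; cong₂; subst)
open import Relation.Nullary using (yes; no; ¬_; contradiction)
open import Relation.Unary using (Pred; Decidable; _∪_; _⊥_; _≬_; _⊆_)
open import Relation.Unary.Properties using (∁?)

private
  variable
    ℓ : Level
    X : Set ℓ
    A B C S T : FinSet X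
    G : Collection X
    m n : ℕ

-- In a duplicate-free list each membership proof is unique, so equality as sets upgrades to
-- equality as bags, that is, to a permutation.
size-cong : S ≈ T → size S ≡ size T
size-cong {S = S} {T = T} (S⊆T , T⊆S) =
  ↭-length (∼bag⇒↭ (unique∧set⇒bag (unique S) (unique T) (mk⇔ S⊆T T⊆S)))

disjointUnion : (A B : FinSet X) → ⟦ A ⟧ ⊥ ⟦ B ⟧ → FinSet X
disjointUnion A B A⊥B =
  finSet (elements A ++ elements B) (++⁺ (unique A) (unique B) A⊥B)

disjointUnion-⊔ : (A⊥B : ⟦ A ⟧ ⊥ ⟦ B ⟧) → disjointUnion A B A⊥B ≈ A ⊔ B
disjointUnion-⊔ {A = A} A⊥B = record
  { disjoint = A⊥B
  ; union    = ∈-++⁻ (elements A) , [ ∈-++⁺ˡ , ∈-++⁺ʳ (elements A) ]′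
  }

size-⊔ : (C A B : FinSet X) → C ≈ A ⊔ B → size C ≡ size A + size B
size-⊔ C A B C≈A⊔B = trans
  (size-cong {S = C} {T = disjointUnion A B disjoint}
    (A∪B⊆AB ∘ proj₁ union , proj₂ union ∘ AB⊆A∪B))
  (length-++ (elements A))
  where
  open _≈_⊔_ C≈A⊔B
  AB⊆A∪B = proj₁ (_≈_⊔_.union (disjointUnion-⊔ {A = A} {B = B} disjoint))
  A∪B⊆AB = proj₂ (_≈_⊔_.union (disjointUnion-⊔ {A = A} {B = B} disjoint))

⊔-resp-≈ : C ≈ S → C ≈ A ⊔ B → S ≈ A ⊔ B
⊔-resp-≈ (C⊆S , S⊆C) C≈A⊔B = record
  { disjoint = disjoint
  ; union    = proj₁ union ∘ S⊆C , C⊆S ∘ proj₂ union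
  }
  where open _≈_⊔_ C≈A⊔B

module _ {P : Pred X ℓ} (P? : Decidable P) where

  restrict : FinSet X → FinSet X
  restrict S = finSet (filter P? (elements S)) (filter⁺ P? (unique S))

  -- A point where `S` meets a block of `G` lies in `Points G`, so filtering by `P` keeps it.
  restrict-blocking : Points G ⊆ P → Blocking G ⟦ S ⟧ → Blocking G ⟦ restrict S ⟧
  restrict-blocking G⊆P S-blocks GB with S-blocks GB
  ... | x , x∈S , x∈B = x , ∈-filter⁺ P? x∈S (G⊆P (_ , GB , x∈B)) , x∈B

split : (S : FinSet X) {P : Pred X ℓ} (P? : Decidable P) → S ≈ restrict P? S ⊔ restrict (∁? P?) S
split S P? = record
  { disjoint = λ (x∈P , x∉P) →
      contradiction (proj₂ (∈-filter⁻ P? {xs = elements S} x∈P))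
                    (proj₂ (∈-filter⁻ (∁? P?) {xs = elements S} x∉P))
  ; union    = to , [ proj₁ ∘ ∈-filter⁻ P? , proj₁ ∘ ∈-filter⁻ (∁? P?) ]′
  }
  where
  to : ⟦ S ⟧ ⊆ (⟦ restrict P? S ⟧ ∪ ⟦ restrict (∁? P?) S ⟧)
  to {x} x∈S with P? x
  ... | yes Px = inj₁ (∈-filter⁺ P? x∈S Px)
  ... | no ¬Px = inj₂ (∈-filter⁺ (∁? P?) x∈S ¬Px)

HasTr-unique : HasTr G m → HasTr G n → m ≡ n
HasTr-unique trm trn = ≤-antisym (bound trm trn) (bound trn trm)
  where
  bound : HasTr G m → HasTr G n → m ≤ n
  bound trm trn with HasTr.attained trn
  ... | S , S-blocks , refl = HasTr.minimal trm S S-blocks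

transversal : (S : FinSet X) → HasTr G n → Blocking G ⟦ S ⟧ → size S ≡ n → (G ^⊤) S
transversal _ tr S-blocks refl = S-blocks , tr

-- If a transversal had a point outside `Points G`, restricting it to `Points G` would leave a
-- strictly smaller blocking set.
Points-⊤⊆ : ExcludedMiddle ℓ → {X : Set ℓ} {G : Collection X} → Points (G ^⊤) ⊆ Points G
Points-⊤⊆ em {G = G} {x} (T , (T-blocks , tr) , x∈T) with em {P = Points G x}
... | yes x∈G = x∈G
... | no  x∉G = contradiction
  (HasTr.minimal tr (restrict G? T) (restrict-blocking G? {G = G} {S = T} id T-blocks))
  (<⇒≱ (filter-notAll G? (elements T) (lose x∈T x∉G)))
  where
  G? : Decidable (Points G)
  G? _ = em

MIF-tr : MIF n G → HasTr G n
MIF-tr {G = G} mif with IsFamily.non-empty (MIF.isFamily mif)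
... | B , GB = subst (HasTr G) (MIF.uniform mif GB) (proj₂ (proj₁ (MIF.maximal mif) GB))

-- Adding the transversals to `G` raises the transversal number from `n` to the block size `m`: by
-- closedness any block of `G` is a transversal of the enlarged family.
CIF-tr : CIF m n G → HasTr (G ∪ G ^⊤) m
CIF-tr {G = G} cif with IsFamily.non-empty (CIF.isFamily cif)
... | B , GB =
  subst (HasTr (G ∪ G ^⊤)) (CIF.uniform cif GB) (proj₂ (proj₁ (CIF.closed cif) GB))

-- Reduces maximality to conditions free of `HasTr`: any block attains the bound `n`, which fixes
-- the transversal number, and `complete` then recognises every transversal as a block.
MIF-intro : IsFamily G → Uniform G n → (∀ {B} → G B → Blocking G ⟦ B ⟧) →
            (∀ S → Blocking G ⟦ S ⟧ → n ≤ size S) →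
            (∀ S → Blocking G ⟦ S ⟧ → size S ≡ n → G S) → MIF n G
MIF-intro {G = G} {n = n} fam uni intersecting lower complete = record
  { isFamily = fam
  ; uniform  = uni
  ; finiteTr = B₀ , intersecting GB₀
  ; maximal  = (λ {B} GB → transversal B tr (intersecting GB) (uni GB))
             , λ (S-blocks , trS) → complete _ S-blocks (HasTr-unique trS tr)
  }
  where
  B₀ = proj₁ (IsFamily.non-empty fam)
  GB₀ = proj₂ (IsFamily.non-empty fam)
  tr : HasTr G n
  tr = record { attained = B₀ , intersecting GB₀ , uni GB₀ ; minimal = lower }

-- The equality case of adding two bounds: slack in either one would make the sum strict.
+-tight : ∀ {a b c d} → a ≤ c → b ≤ d → c + d ≡ a + b → c ≡ a × d ≡ b
+-tight {a} {b} {c} {d} a≤c b≤d c+d≡a+b =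
  ≤-antisym (+-cancelʳ-≤ d c a (≤-trans (≤-reflexive c+d≡a+b) (+-monoʳ-≤ a b≤d))) a≤c ,
  ≤-antisym (+-cancelˡ-≤ c d b (≤-trans (≤-reflexive c+d≡a+b) (+-monoˡ-≤ b a≤c))) b≤d

theorem2p7 : ∀ {ℓ} → ExcludedMiddle ℓ → {X : Set ℓ} (k t : ℕ) → 0 < k → 0 < t → t < k →
    (A F : Collection X) → MIF (k ∸ t) A → CIF k t F → Points A ⊥ Points F →
    (Points A ⊥ Points (F ^⊤)) × (F ⊥ (A ⊛ F ^⊤)) × MIF k (F ∪ (A ⊛ F ^⊤))
theorem2p7 {ℓ} em {X} k t _ _ t<k 𝒜 ℱ mif cif 𝒜⊥ℱ =
  𝒜⊥ℱ⊤ , ℱ⊥𝒜⊛ℱ⊤ , MIF-intro family uniform intersecting lower complete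
  where
  module M = MIF mif
  module C = CIF cif

  𝒢 : Collection X
  𝒢 = ℱ ∪ (𝒜 ⊛ ℱ ^⊤)

  𝒜⊥ℱ⊤ : Points 𝒜 ⊥ Points (ℱ ^⊤)
  𝒜⊥ℱ⊤ (x∈𝒜 , x∈ℱ⊤) = 𝒜⊥ℱ (x∈𝒜 , Points-⊤⊆ em x∈ℱ⊤)

  -- The part of a common block coming from `𝒜` is non-empty, and its points would lie in both point
  -- sets.
  ℱ⊥𝒜⊛ℱ⊤ : ℱ ⊥ (𝒜 ⊛ ℱ ^⊤)
  ℱ⊥𝒜⊛ℱ⊤ (ℱC , A , B , 𝒜A , _ , C≈A⊔B) with IsFamily.blocks M.isFamily 𝒜A
  ... | x , x∈A = 𝒜⊥ℱ ((A , 𝒜A , x∈A) , (_ , ℱC , proj₂ (_≈_⊔_.union C≈A⊔B) (inj₁ x∈A)))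

  family : IsFamily 𝒢
  family = record
    { respects = λ where
        C≈S (inj₁ ℱC) → inj₁ (IsFamily.respects C.isFamily C≈S ℱC)
        {C} {S} C≈S (inj₂ (A , B , 𝒜A , ℱ⊤B , C≈A⊔B)) →
          inj₂ (A , B , 𝒜A , ℱ⊤B , ⊔-resp-≈ {C = C} {S = S} C≈S C≈A⊔B)
    ; non-empty = let B , ℱB = IsFamily.non-empty C.isFamily in B , inj₁ ℱB
    ; blocks = λ where
        (inj₁ ℱC) → IsFamily.blocks C.isFamily ℱC
        (inj₂ (A , B , 𝒜A , _ , C≈A⊔B)) →
          let x , x∈A = IsFamily.blocks M.isFamily 𝒜A
          in x , proj₂ (_≈_⊔_.union C≈A⊔B) (inj₁ x∈A)
    }

  k∸t+t≡k : k ∸ t + t ≡ k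
  k∸t+t≡k = m∸n+n≡m (<⇒≤ t<k)

  uniform : Uniform 𝒢 k
  uniform (inj₁ ℱC) = C.uniform ℱC
  uniform {C} (inj₂ (A , B , 𝒜A , (_ , trB) , C≈A⊔B)) =
    trans (size-⊔ C A B C≈A⊔B)
      (trans (cong₂ _+_ (M.uniform 𝒜A) (HasTr-unique trB C.hasTr)) k∸t+t≡k)

  ℱ-blocks : ∀ C → ℱ C → Blocking (ℱ ∪ ℱ ^⊤) ⟦ C ⟧
  ℱ-blocks C ℱC = proj₁ (proj₁ C.closed ℱC)

  intersecting : ∀ {C} → 𝒢 C → Blocking 𝒢 ⟦ C ⟧
  intersecting {C} (inj₁ ℱC) (inj₁ ℱC′) = ℱ-blocks C ℱC (inj₁ ℱC′)
  intersecting {C} (inj₁ ℱC) (inj₂ (_ , B′ , _ , ℱ⊤B′ , C′≈A′⊔B′)) =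
    let x , x∈C , x∈B′ = ℱ-blocks C ℱC {B′} (inj₂ ℱ⊤B′)
    in x , x∈C , proj₂ (_≈_⊔_.union C′≈A′⊔B′) (inj₂ x∈B′)
  intersecting (inj₂ (_ , _ , _ , (B-blocks , _) , C≈A⊔B)) (inj₁ ℱC′) =
    let x , x∈B , x∈C′ = B-blocks ℱC′
    in x , proj₂ (_≈_⊔_.union C≈A⊔B) (inj₂ x∈B) , x∈C′
  intersecting (inj₂ (_ , _ , 𝒜A , _ , C≈A⊔B)) (inj₂ (_ , _ , 𝒜A′ , _ , C′≈A′⊔B′)) =
    let x , x∈A , x∈A′ = proj₁ (proj₁ M.maximal 𝒜A) 𝒜A′
    in x , proj₂ (_≈_⊔_.union C≈A⊔B) (inj₁ x∈A) , proj₂ (_≈_⊔_.union C′≈A′⊔B′) (inj₁ x∈A′)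

  -- `𝒜` may be infinite, so the test for cutting `S` along its point set comes from excluded
  -- middle.
  𝒜? : Decidable (Points 𝒜)
  𝒜? _ = em

  module _ (S : FinSet X) (S-blocks : Blocking 𝒢 ⟦ S ⟧) where

    blocks-𝒜 : ∀ B → (ℱ ^⊤) B → ¬ (⟦ S ⟧ ≬ ⟦ B ⟧) → Blocking 𝒜 ⟦ S ⟧
    blocks-𝒜 B ℱ⊤B S∩B≡∅ {A} 𝒜A
      with S-blocks (inj₂ (A , B , 𝒜A , ℱ⊤B , disjointUnion-⊔ {A = A} {B = B} A⊥B))
      where
      A⊥B : ⟦ A ⟧ ⊥ ⟦ B ⟧
      A⊥B (x∈A , x∈B) = 𝒜⊥ℱ⊤ ((A , 𝒜A , x∈A) , (B , ℱ⊤B , x∈B))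
    ... | x , x∈S , x∈AB with ∈-++⁻ (elements A) x∈AB
    ...   | inj₁ x∈A = x , x∈S , x∈A
    ...   | inj₂ x∈B = contradiction (x , x∈S , x∈B) S∩B≡∅

    -- The bound and its equality case are proved together, as both rest on the same case
    -- distinction.
    large-or-block : k ≤ size S × (size S ≡ k → 𝒢 S)
    large-or-block with em {P = ∃ λ B → (ℱ ^⊤) B × ¬ (⟦ S ⟧ ≬ ⟦ B ⟧)}
    ... | no none =
      HasTr.minimal (CIF-tr cif) S S-blocks-∪ ,
      λ |S|≡k → inj₁ (proj₂ C.closed (transversal S (CIF-tr cif) S-blocks-∪ |S|≡k))
      where
      S-blocks-∪ : Blocking (ℱ ∪ ℱ ^⊤) ⟦ S ⟧
      S-blocks-∪ (inj₁ ℱB) = S-blocks (inj₁ ℱB)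
      -- `none` only denies that some `B` is missed; excluded middle turns this into an actual
      -- common point.
      S-blocks-∪ {B} (inj₂ ℱ⊤B) with em {P = ⟦ S ⟧ ≬ ⟦ B ⟧}
      ... | yes S≬B = S≬B
      ... | no ¬S≬B = contradiction (B , ℱ⊤B , ¬S≬B) none
    ... | yes (B , ℱ⊤B , S∩B≡∅) =
      ≤-trans (≤-reflexive (sym k∸t+t≡k))
        (≤-trans (+-mono-≤ k∸t≤ t≤) (≤-reflexive (sym |S|))) ,
      -- Both bounds are now tight, so `S₁` and `S₂` are themselves transversals of `𝒜` and `ℱ`. The
      -- second component is `S₂`, not the missed `B`, which served only to make `S` block `𝒜`.
      λ |S|≡k →
        let |S₁| , |S₂| = +-tight k∸t≤ t≤ (trans (sym |S|) (trans |S|≡k (sym k∸t+t≡k)))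
        in inj₂ (S₁ , S₂ , proj₂ M.maximal (transversal S₁ (MIF-tr mif) S₁-blocks |S₁|) ,
                 transversal S₂ C.hasTr S₂-blocks |S₂| , split S 𝒜?)
      where
      S₁ = restrict 𝒜? S
      S₂ = restrict (∁? 𝒜?) S

      S₁-blocks : Blocking 𝒜 ⟦ S₁ ⟧
      S₁-blocks = restrict-blocking 𝒜? {G = 𝒜} {S = S} id (blocks-𝒜 B ℱ⊤B S∩B≡∅)

      -- Removing the points of `𝒜` loses no point of `ℱ`, since the point sets are disjoint.
      S₂-blocks : Blocking ℱ ⟦ S₂ ⟧
      S₂-blocks = restrict-blocking (∁? 𝒜?) {G = ℱ} {S = S}
        (λ x∈ℱ x∈𝒜 → 𝒜⊥ℱ (x∈𝒜 , x∈ℱ)) (S-blocks ∘ inj₁)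

      k∸t≤ : k ∸ t ≤ size S₁
      k∸t≤ = HasTr.minimal (MIF-tr mif) S₁ S₁-blocks

      t≤ : t ≤ size S₂
      t≤ = HasTr.minimal C.hasTr S₂ S₂-blocks

      |S| : size S ≡ size S₁ + size S₂
      |S| = size-⊔ S S₁ S₂ (split S 𝒜?)

  lower : ∀ S → Blocking 𝒢 ⟦ S ⟧ → k ≤ size S
  lower S S-blocks = proj₁ (large-or-block S S-blocks)

  complete : ∀ S → Blocking 𝒢 ⟦ S ⟧ → size S ≡ k → 𝒢 S
  complete S S-blocks = proj₂ (large-or-block S S-blocks)
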